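{- For every integer $n\ge 1$, the geometric polynomials satisfy the recurrence relation $$F_{n}(x)=x\sum_{k=0}^{n-1}\binom{n}{k}F_{k}(x).$$
   Context: For integers $n,k\ge 0$, ${n\brace k}$ denotes the Stirling number of the second kind, defined by $\sum_{n=0}^{\infty}{n\brace k}\frac{x^n}{n!}=\frac{(e^x-1)^k}{k!}$. The $n$-th geometric (Fubini) polynomial is $F_n(x)=\sum_{k=0}^{n}{n\brace k}k!\,x^k$ (so $F_0(x)=1$, $F_1(x)=x$, $F_2(x)=x+2x^2$). -}

module Defs where

open import Algebra.Bundles using (RawSemiring)
import Algebra.Definitions.RawSemiring as RawSemiringDefinitions
open import Data.Fin.Base using (toℕ)
open import Data.Integer.Base using (+_)
open import Data.List.Base using (List; []; _∷_; map)
open import Data.Nat.Base using (ℕ; zero; suc; _∸_; _!)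
open import Data.Nat.Properties using (_!≢0)
open import Data.Rational.Base using (ℚ; 0ℚ; 1ℚ; _/_; _+_; _*_; _-_; +-*-rawSemiring)
open import Level using (0ℓ)
open import Relation.Binary.PropositionalEquality.Core using (_≡_)

fromℕ : ℕ → ℚ
fromℕ n = + n / 1

1/_! : ℕ → ℚ
1/ n ! = _/_ (+ 1) (n !) {{n !≢0}}

module Σℚ = RawSemiringDefinitions +-*-rawSemiring

-- Formal power series over ℚ: f n is the coefficient of xⁿ.

Series : Set
Series = ℕ → ℚ

0ˢ 1ˢ : Series
0ˢ _ = 0ℚ
1ˢ zero    = 1ℚ
1ˢ (suc _) = 0ℚ

infixl 6 _+ˢ_ _-ˢ_
infixl 7 _*ˢ_ _·ˢ_

_+ˢ_ _-ˢ_ _*ˢ_ : Series → Series → Series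
(f +ˢ g) n = f n + g n
(f -ˢ g) n = f n - g n
(f *ˢ g) n = Σℚ.sum {suc n} λ i → f (toℕ i) * g (n ∸ toℕ i)

_·ˢ_ : ℚ → Series → Series
(a ·ˢ f) n = a * f n

seriesRawSemiring : RawSemiring 0ℓ 0ℓ
seriesRawSemiring = record
  { Carrier = Series
  ; _≈_     = λ f g → ∀ n → f n ≡ g n
  ; _+_     = _+ˢ_
  ; _*_     = _*ˢ_
  ; 0#      = 0ˢ
  ; 1#      = 1ˢ
  }

open RawSemiringDefinitions seriesRawSemiring public
  using () renaming (_^_ to _^ˢ_)

exp : Series
exp n = 1/ n !

-- The rational number S(n,k) such that S(n,k)/n! is the coefficient of xⁿ
-- in (eˣ - 1)ᵏ/k!.

stirling₂ : ℕ → ℕ → ℚ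
stirling₂ n k = fromℕ (n !) * (1/ k ! ·ˢ (exp -ˢ 1ˢ) ^ˢ k) n

-- Polynomials over ℚ as coefficient lists, constant term first.  Trailing
-- zeros are allowed, so equality is _≈ᵖ_ and not _≡_.

Poly : Set
Poly = List ℚ

coeff : Poly → ℕ → ℚ
coeff []      _       = 0ℚ
coeff (a ∷ _) zero    = a
coeff (_ ∷ p) (suc i) = coeff p i

infix 4 _≈ᵖ_

_≈ᵖ_ : Poly → Poly → Set
p ≈ᵖ q = ∀ i → coeff p i ≡ coeff q i

infixl 6 _+ᵖ_
infixl 7 _*ᵖ_ _·ᵖ_

_+ᵖ_ : Poly → Poly → Poly
[]      +ᵖ q       = q
(a ∷ p) +ᵖ []      = a ∷ p
(a ∷ p) +ᵖ (b ∷ q) = (a + b) ∷ (p +ᵖ q)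

_·ᵖ_ : ℚ → Poly → Poly
a ·ᵖ p = map (a *_) p

_*ᵖ_ : Poly → Poly → Poly
[]      *ᵖ q = []
(a ∷ p) *ᵖ q = a ·ᵖ q +ᵖ (0ℚ ∷ p *ᵖ q)

0ᵖ 1ᵖ X : Poly
0ᵖ = []
1ᵖ = 1ℚ ∷ []
X  = 0ℚ ∷ 1ℚ ∷ []

polyRawSemiring : RawSemiring 0ℓ 0ℓ
polyRawSemiring = record
  { Carrier = Poly
  ; _≈_     = _≈ᵖ_
  ; _+_     = _+ᵖ_
  ; _*_     = _*ᵖ_
  ; 0#      = 0ᵖ
  ; 1#      = 1ᵖ
  }

open RawSemiringDefinitions polyRawSemiring public
  using () renaming (_^_ to _^ᵖ_; sum to sumᵖ)

-- ∑ᵖ[ k < n ] p has k : ℕ running over 0, …, n - 1.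

∑ᵖ< : ℕ → (ℕ → Poly) → Poly
∑ᵖ< n p = sumᵖ {n} λ i → p (toℕ i)

infixl 6.5 ∑ᵖ<
syntax ∑ᵖ< n (λ k → p) = ∑ᵖ[ k < n ] p

F : ℕ → Poly
F n = ∑ᵖ[ k < suc n ] ((stirling₂ n k * fromℕ (k !)) ·ᵖ X ^ᵖ k)

{-# OPTIONS --safe #-}
-- Write E = eˣ - 1.  The coefficient of Xʲ in F n is n! [xⁿ] Eʲ for every j,
-- since E has no constant term and so [xⁿ] Eʲ = 0 for j > n.  The coefficient
-- of Xʲ⁺¹ in the recurrence is then the Cauchy product Eʲ⁺¹ = E · Eʲ read off at
-- xⁿ, because n! [xⁿ⁻ᵏ] E = (n C k) k! for k < n and [x⁰] E = 0.
module Submission where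

open import Defs
open import Data.Nat.Base using (ℕ; _≤_)
open import Data.Nat.Combinatorics using (_C_)

open import Algebra.Bundles using (CommutativeRing)
import Algebra.Properties.CommutativeSemigroup as CommutativeSemigroupProperties
import Algebra.Properties.Semiring.Sum as SemiringSum
open import Data.Fin.Base using (Fin; toℕ; opposite) renaming (zero to fzero; suc to fsuc)
open import Data.Fin.Permutation using (reverse)
open import Data.Fin.Properties using (toℕ<n; opposite-prop)
open import Data.Integer.Base using (+_)
import Data.Integer.Properties as ℤ
open import Data.List.Base using ([]; _∷_)
open import Data.Nat.Base as ℕ using (zero; suc; _∸_; _!; _<_; z≤n; s≤s)
open import Data.Nat.Combinatorics using (nCk≡nC[n∸k]; nCk≡n!/k![n-k]!; k![n∸k]!∣n!)
open import Data.Nat.DivMod using (m/n*n≡m)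
import Data.Nat.Properties as ℕ
open import Data.Rational.Base using (ℚ; 0ℚ; 1ℚ; _/_; _+_; _*_; fromℚᵘ)
open import Data.Rational.Properties
open import Data.Rational.Unnormalised.Base as ℚᵘ using (mkℚᵘ)
import Data.Rational.Unnormalised.Properties as ℚᵘ
open import Relation.Binary.PropositionalEquality

open SemiringSum (CommutativeRing.semiring +-*-commutativeRing)
  using (sum; sum-cong-≗; sum-replicate-zero; sum-permute; *-distribˡ-sum)
open CommutativeSemigroupProperties
  (CommutativeRing.*-commutativeSemigroup +-*-commutativeRing)
  using (xy∙z≈xz∙y)
open ≡-Reasoning

-- Factorials and binomial coefficients as rationals.

fromℚᵘ-homo-* : ∀ p q → fromℚᵘ (p ℚᵘ.* q) ≡ fromℚᵘ p * fromℚᵘ q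
-- The product on `ℚ` normalises, so both sides are compared after the injective `toℚᵘ`, where each
-- is `p ℚᵘ.* q` up to `≃`.
fromℚᵘ-homo-* p q = toℚᵘ-injective (ℚᵘ.≃-trans (toℚᵘ-fromℚᵘ (p ℚᵘ.* q))
  (ℚᵘ.≃-sym (ℚᵘ.≃-trans (toℚᵘ-homo-* (fromℚᵘ p) (fromℚᵘ q))
    (ℚᵘ.*-cong (toℚᵘ-fromℚᵘ p) (toℚᵘ-fromℚᵘ q)))))

fromℕ-homo-* : ∀ m n → fromℕ (m ℕ.* n) ≡ fromℕ m * fromℕ n
fromℕ-homo-* m n = begin
  + (m ℕ.* n) / 1                        ≡⟨ /-cong (ℤ.pos-* m n) refl ⟩
  fromℚᵘ (mkℚᵘ (+ m) 0 ℚᵘ.* mkℚᵘ (+ n) 0) ≡⟨ fromℚᵘ-homo-* (mkℚᵘ (+ m) 0) (mkℚᵘ (+ n) 0) ⟩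
  fromℕ m * fromℕ n                      ∎

1/n*n≡1 : ∀ n .{{_ : ℕ.NonZero n}} → (+ 1 / n) * fromℕ n ≡ 1ℚ
1/n*n≡1 (suc n) = begin
  (+ 1 / suc n) * fromℕ (suc n)                 ≡⟨ fromℚᵘ-homo-* (mkℚᵘ (+ 1) n) (mkℚᵘ (+ suc n) 0) ⟨
  -- The second argument of `mkℚᵘ` is the denominator minus one, so the left factor is by
  -- computation the reciprocal of the right one.
  fromℚᵘ (mkℚᵘ (+ 1) n ℚᵘ.* mkℚᵘ (+ suc n) 0) ≡⟨ fromℚᵘ-cong (ℚᵘ.*-inverseˡ (mkℚᵘ (+ suc n) 0)) ⟩
  1ℚ                                            ∎

1/n!*n!≡1 : ∀ n → 1/ n ! * fromℕ (n !) ≡ 1ℚ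
1/n!*n!≡1 n = 1/n*n≡1 (n !) {{n ℕ.!≢0}}

nCk*[k!*[n∸k]!]≡n! : ∀ {n k} → k ≤ n → (n C k) ℕ.* (k ! ℕ.* (n ∸ k) !) ≡ n !
nCk*[k!*[n∸k]!]≡n! {n} {k} k≤n = trans
  (cong (ℕ._* (k ! ℕ.* (n ∸ k) !)) (nCk≡n!/k![n-k]! k≤n))
  (m/n*n≡m {{k ℕ.!* (n ∸ k) !≢0}} (k![n∸k]!∣n! k≤n))

-- In the Cauchy product `k` is the degree taken from `expm1`, and `n ∸ k`, the degree left to the
-- other factor, becomes the index of the recurrence. Symmetry of the binomial coefficient allows
-- writing the right side in `n ∸ k`.
n!/k!≡nC[n∸k]*[n∸k]! : ∀ {n k} → k ≤ n →
  fromℕ (n !) * 1/ k ! ≡ fromℕ (n C (n ∸ k)) * fromℕ ((n ∸ k) !)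
n!/k!≡nC[n∸k]*[n∸k]! {n} {k} k≤n = begin
  fromℕ (n !) * 1/ k !                  ≡⟨ cong (λ m → fromℕ m * 1/ k !) n!-split ⟩
  fromℕ (b ℕ.* k !) * 1/ k !            ≡⟨ cong (_* 1/ k !) (fromℕ-homo-* b (k !)) ⟩
  fromℕ b * fromℕ (k !) * 1/ k !        ≡⟨ *-assoc (fromℕ b) (fromℕ (k !)) (1/ k !) ⟩
  fromℕ b * (fromℕ (k !) * 1/ k !)      ≡⟨ cong (fromℕ b *_) (*-comm (fromℕ (k !)) (1/ k !)) ⟩
  fromℕ b * (1/ k ! * fromℕ (k !))      ≡⟨ cong (fromℕ b *_) (1/n!*n!≡1 k) ⟩
  fromℕ b * 1ℚ                          ≡⟨ *-identityʳ (fromℕ b) ⟩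
  fromℕ b                               ≡⟨ fromℕ-homo-* (n C (n ∸ k)) ((n ∸ k) !) ⟩
  fromℕ (n C (n ∸ k)) * fromℕ ((n ∸ k) !) ∎
  where
  b : ℕ
  b = (n C (n ∸ k)) ℕ.* (n ∸ k) !

  n!-split : n ! ≡ b ℕ.* k !
  n!-split = begin
    n !                                             ≡⟨ nCk*[k!*[n∸k]!]≡n! k≤n ⟨
    (n C k) ℕ.* (k ! ℕ.* (n ∸ k) !)                 ≡⟨ cong₂ ℕ._*_ (nCk≡nC[n∸k] k≤n) (ℕ.*-comm (k !) ((n ∸ k) !)) ⟩
    (n C (n ∸ k)) ℕ.* ((n ∸ k) ! ℕ.* k !)           ≡⟨ ℕ.*-assoc (n C (n ∸ k)) ((n ∸ k) !) (k !) ⟨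
    b ℕ.* k !                                       ∎

sum-zero : ∀ {n} (f : Fin n → ℚ) → (∀ i → f i ≡ 0ℚ) → sum f ≡ 0ℚ
sum-zero {n} f f≡0 = trans (sum-cong-≗ f≡0) (sum-replicate-zero n)

-- Power series without constant term.

expm1 : Series
expm1 = exp -ˢ 1ˢ

-- The head of the Cauchy sum is `f 0 * g n`. Once it is gone, `g` is evaluated only at degrees
-- below `n`.
*ˢ-zeroConst : ∀ f g → f 0 ≡ 0ℚ → ∀ n →
  (f *ˢ g) n ≡ sum {n} (λ i → f (suc (toℕ i)) * g (n ∸ suc (toℕ i)))
*ˢ-zeroConst f g f0≡0 n = begin
  f 0 * g n + s  ≡⟨ cong (λ a → a * g n + s) f0≡0 ⟩
  0ℚ * g n + s   ≡⟨ cong (_+ s) (*-zeroˡ (g n)) ⟩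
  0ℚ + s         ≡⟨ +-identityˡ s ⟩
  s              ∎
  where
  s : ℚ
  s = sum {n} (λ i → f (suc (toℕ i)) * g (n ∸ suc (toℕ i)))

-- Induction on `j`: after one factor `f` is split off, the remaining power is read at a degree
-- below `n`, hence below the smaller exponent.
^ˢ-order : ∀ f → f 0 ≡ 0ℚ → ∀ j n → n < j → (f ^ˢ j) n ≡ 0ℚ
^ˢ-order f f0≡0 (suc j) n (s≤s n≤j) = trans (*ˢ-zeroConst f (f ^ˢ j) f0≡0 n)
  (sum-zero _ λ i → trans
    (cong (f (suc (toℕ i)) *_) (^ˢ-order f f0≡0 j _ (ℕ.<-≤-trans (n∸1+i<n i) n≤j)))
    (*-zeroʳ (f (suc (toℕ i)))))
  where
  n∸1+i<n : ∀ {n} (i : Fin n) → n ∸ suc (toℕ i) < n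
  n∸1+i<n {suc n} i = s≤s (ℕ.m∸n≤m n (toℕ i))

-- Coefficients of polynomials.

coeff-+ᵖ : ∀ p q j → coeff (p +ᵖ q) j ≡ coeff p j + coeff q j
coeff-+ᵖ []      q       j       = sym (+-identityˡ (coeff q j))
coeff-+ᵖ (a ∷ p) []      j       = sym (+-identityʳ (coeff (a ∷ p) j))
coeff-+ᵖ (a ∷ p) (b ∷ q) zero    = refl
coeff-+ᵖ (a ∷ p) (b ∷ q) (suc j) = coeff-+ᵖ p q j

coeff-·ᵖ : ∀ a p j → coeff (a ·ᵖ p) j ≡ a * coeff p j
coeff-·ᵖ a []      j       = sym (*-zeroʳ a)
coeff-·ᵖ a (b ∷ p) zero    = refl
coeff-·ᵖ a (b ∷ p) (suc j) = coeff-·ᵖ a p j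

coeff-sumᵖ : ∀ {n} (p : Fin n → Poly) j → coeff (sumᵖ p) j ≡ sum (λ i → coeff (p i) j)
coeff-sumᵖ {zero}  p j = refl
coeff-sumᵖ {suc n} p j = trans (coeff-+ᵖ (p fzero) _ j)
  (cong (λ s → coeff (p fzero) j + s) (coeff-sumᵖ (λ i → p (fsuc i)) j))

coeff-X*-zero : ∀ p → coeff (X *ᵖ p) 0 ≡ 0ℚ
coeff-X*-zero p = begin
  -- `X *ᵖ p` does not compute to a plain shift of `p`; it unfolds to this sum, whose first summand
  -- has only zero coefficients.
  coeff (X *ᵖ p) 0           ≡⟨ coeff-+ᵖ (0ℚ ·ᵖ p) (0ℚ ∷ 1ᵖ *ᵖ p) 0 ⟩
  coeff (0ℚ ·ᵖ p) 0 + 0ℚ     ≡⟨ +-identityʳ _ ⟩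
  coeff (0ℚ ·ᵖ p) 0          ≡⟨ coeff-·ᵖ 0ℚ p 0 ⟩
  0ℚ * coeff p 0             ≡⟨ *-zeroˡ (coeff p 0) ⟩
  0ℚ                         ∎

coeff-1* : ∀ p j → coeff (1ᵖ *ᵖ p) j ≡ coeff p j
coeff-1* p j = begin
  -- The product ends in a summand `0ℚ ∷ []`, which for `p = []` leaves a trailing zero.
  coeff (1ᵖ *ᵖ p) j                      ≡⟨ coeff-+ᵖ (1ℚ ·ᵖ p) (0ℚ ∷ []) j ⟩
  coeff (1ℚ ·ᵖ p) j + coeff (0ℚ ∷ []) j  ≡⟨ cong₂ _+_ (coeff-·ᵖ 1ℚ p j) (coeff-0∷[] j) ⟩
  1ℚ * coeff p j + 0ℚ                    ≡⟨ +-identityʳ _ ⟩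
  1ℚ * coeff p j                         ≡⟨ *-identityˡ (coeff p j) ⟩
  coeff p j                              ∎
  where
  coeff-0∷[] : ∀ j → coeff (0ℚ ∷ []) j ≡ 0ℚ
  coeff-0∷[] zero    = refl
  coeff-0∷[] (suc j) = refl

coeff-X*-suc : ∀ p j → coeff (X *ᵖ p) (suc j) ≡ coeff p j
coeff-X*-suc p j = begin
  coeff (X *ᵖ p) (suc j)                       ≡⟨ coeff-+ᵖ (0ℚ ·ᵖ p) (0ℚ ∷ 1ᵖ *ᵖ p) (suc j) ⟩
  coeff (0ℚ ·ᵖ p) (suc j) + coeff (1ᵖ *ᵖ p) j  ≡⟨ cong₂ _+_ (coeff-·ᵖ 0ℚ p (suc j)) (coeff-1* p j) ⟩
  0ℚ * coeff p (suc j) + coeff p j             ≡⟨ cong (_+ coeff p j) (*-zeroˡ (coeff p (suc j))) ⟩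
  0ℚ + coeff p j                               ≡⟨ +-identityˡ (coeff p j) ⟩
  coeff p j                                    ∎

-- As `a` vanishes from `m` on, the result covers every `j`, also beyond the range of the sum. The
-- induction lowers `m` and `j` together and shifts `a`.
sum-coeff-X^ : ∀ m (a : ℕ → ℚ) → (∀ k → m ≤ k → a k ≡ 0ℚ) → ∀ j →
  sum {m} (λ i → a (toℕ i) * coeff (X ^ᵖ toℕ i) j) ≡ a j
sum-coeff-X^ zero    a a≡0 j       = sym (a≡0 j z≤n)
sum-coeff-X^ (suc m) a a≡0 zero    = begin
  a 0 * 1ℚ + sum {m} (λ i → a (suc (toℕ i)) * coeff (X ^ᵖ suc (toℕ i)) 0)
    ≡⟨ cong₂ _+_ (*-identityʳ (a 0)) (sum-zero {m} _ λ i → trans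
         (cong (a (suc (toℕ i)) *_) (coeff-X*-zero (X ^ᵖ toℕ i)))
         (*-zeroʳ (a (suc (toℕ i))))) ⟩
  a 0 + 0ℚ
    ≡⟨ +-identityʳ (a 0) ⟩
  a 0 ∎
sum-coeff-X^ (suc m) a a≡0 (suc j) = begin
  -- The power `X ^ᵖ 0` has no coefficient at `suc j`; every other power gives up one factor `X`.
  a 0 * 0ℚ + sum {m} (λ i → a (suc (toℕ i)) * coeff (X ^ᵖ suc (toℕ i)) (suc j))
    ≡⟨ cong₂ _+_ (*-zeroʳ (a 0)) (sum-cong-≗ {m} λ i →
         cong (a (suc (toℕ i)) *_) (coeff-X*-suc (X ^ᵖ toℕ i) j)) ⟩
  0ℚ + sum {m} (λ i → a (suc (toℕ i)) * coeff (X ^ᵖ toℕ i) j)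
    ≡⟨ +-identityˡ _ ⟩
  sum {m} (λ i → a (suc (toℕ i)) * coeff (X ^ᵖ toℕ i) j)
    ≡⟨ sum-coeff-X^ m (λ k → a (suc k)) (λ k m≤k → a≡0 (suc k) (s≤s m≤k)) j ⟩
  a (suc j) ∎

-- Coefficients of the geometric polynomials and the recurrence.

stirling₂*k! : ∀ n k → stirling₂ n k * fromℕ (k !) ≡ fromℕ (n !) * (expm1 ^ˢ k) n
stirling₂*k! n k = begin
  fromℕ (n !) * (1/ k ! * e) * fromℕ (k !)   ≡⟨ *-assoc (fromℕ (n !)) (1/ k ! * e) (fromℕ (k !)) ⟩
  fromℕ (n !) * (1/ k ! * e * fromℕ (k !))   ≡⟨ cong (fromℕ (n !) *_) (xy∙z≈xz∙y (1/ k !) e (fromℕ (k !))) ⟩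
  fromℕ (n !) * (1/ k ! * fromℕ (k !) * e)   ≡⟨ cong (λ u → fromℕ (n !) * (u * e)) (1/n!*n!≡1 k) ⟩
  fromℕ (n !) * (1ℚ * e)                     ≡⟨ cong (fromℕ (n !) *_) (*-identityˡ e) ⟩
  fromℕ (n !) * e                            ∎
  where
  e : ℚ
  e = (expm1 ^ˢ k) n

coeff-F : ∀ n j → coeff (F n) j ≡ fromℕ (n !) * (expm1 ^ˢ j) n
coeff-F n j = begin
  coeff (F n) j
    ≡⟨ coeff-sumᵖ {suc n} (λ i → (stirling₂ n (toℕ i) * fromℕ (toℕ i !)) ·ᵖ X ^ᵖ toℕ i) j ⟩
  sum {suc n} (λ i → coeff ((stirling₂ n (toℕ i) * fromℕ (toℕ i !)) ·ᵖ X ^ᵖ toℕ i) j)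
    ≡⟨ sum-cong-≗ {suc n} (λ i → trans
         (coeff-·ᵖ (stirling₂ n (toℕ i) * fromℕ (toℕ i !)) (X ^ᵖ toℕ i) j)
         (cong (_* coeff (X ^ᵖ toℕ i) j) (stirling₂*k! n (toℕ i)))) ⟩
  sum {suc n} (λ i → fromℕ (n !) * (expm1 ^ˢ toℕ i) n * coeff (X ^ᵖ toℕ i) j)
    -- `^ˢ-order` provides the vanishing beyond `n`; its `refl` says that the constant term of
    -- `expm1` computes to `0ℚ`.
    ≡⟨ sum-coeff-X^ (suc n) (λ k → fromℕ (n !) * (expm1 ^ˢ k) n)
         (λ k n<k → trans (cong (fromℕ (n !) *_) (^ˢ-order expm1 refl k n n<k))
                          (*-zeroʳ (fromℕ (n !)))) j ⟩
  fromℕ (n !) * (expm1 ^ˢ j) n ∎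

-- For exponential generating functions, multiplying by `expm1` is binomial convolution with 0, 1,
-- 1, ...; the leading 0 removes the term at index `n`.
n!*expm1* : ∀ g n →
  fromℕ (n !) * (expm1 *ˢ g) n ≡ sum {n} (λ i → fromℕ (n C toℕ i) * (fromℕ (toℕ i !) * g (toℕ i)))
n!*expm1* g n = begin
  fromℕ (n !) * (expm1 *ˢ g) n
    ≡⟨ cong (fromℕ (n !) *_) (*ˢ-zeroConst expm1 g refl n) ⟩
  fromℕ (n !) * sum {n} (λ i → expm1 (suc (toℕ i)) * g (n ∸ suc (toℕ i)))
    ≡⟨ *-distribˡ-sum {n} (fromℕ (n !)) _ ⟩
  sum {n} (λ i → fromℕ (n !) * (expm1 (suc (toℕ i)) * g (n ∸ suc (toℕ i))))
    ≡⟨ sum-cong-≗ {n} term ⟩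
  sum {n} (λ i → h (toℕ (opposite i)))
    -- The Cauchy sum runs over the degree of `expm1`; reversing it makes the degree of `g` the
    -- index.
    ≡⟨ sum-permute {n} (λ i → h (toℕ i)) reverse ⟨
  sum {n} (λ i → h (toℕ i)) ∎
  where
  h : ℕ → ℚ
  h k = fromℕ (n C k) * (fromℕ (k !) * g k)

  term : ∀ (i : Fin n) →
    fromℕ (n !) * (expm1 (suc (toℕ i)) * g (n ∸ suc (toℕ i))) ≡ h (toℕ (opposite i))
  term i = begin
    -- Since `k` is a successor, `1ˢ` contributes `0ℚ` here, and `- 0ℚ` computes to `0ℚ`.
    fromℕ (n !) * (expm1 k * g l)               ≡⟨ cong (λ u → fromℕ (n !) * (u * g l)) (+-identityʳ (exp k)) ⟩
    fromℕ (n !) * (1/ k ! * g l)                ≡⟨ *-assoc (fromℕ (n !)) (1/ k !) (g l) ⟨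
    fromℕ (n !) * 1/ k ! * g l                  ≡⟨ cong (_* g l) (n!/k!≡nC[n∸k]*[n∸k]! (toℕ<n i)) ⟩
    fromℕ (n C l) * fromℕ (l !) * g l           ≡⟨ *-assoc (fromℕ (n C l)) (fromℕ (l !)) (g l) ⟩
    h l                                         ≡⟨ cong h (opposite-prop i) ⟨
    h (toℕ (opposite i))                        ∎
    where
    k l : ℕ
    k = suc (toℕ i)
    l = n ∸ k

proposition9 : ∀ (n : ℕ) → 1 ≤ n → F n ≈ᵖ X *ᵖ (∑ᵖ[ k < n ] (fromℕ (n C k) ·ᵖ F k))
proposition9 n@(suc _) _ zero = begin
  coeff (F n) 0     ≡⟨ coeff-F n 0 ⟩
  -- `expm1 ^ˢ 0` is `1ˢ`, whose coefficient at the successor `n` is `0ℚ`; here `1 ≤ n` enters.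
  fromℕ (n !) * 0ℚ  ≡⟨ *-zeroʳ (fromℕ (n !)) ⟩
  0ℚ                ≡⟨ coeff-X*-zero (∑ᵖ[ k < n ] (fromℕ (n C k) ·ᵖ F k)) ⟨
  coeff (X *ᵖ (∑ᵖ[ k < n ] (fromℕ (n C k) ·ᵖ F k))) 0 ∎
proposition9 n 1≤n (suc j) = begin
  coeff (F n) (suc j)
    ≡⟨ coeff-F n (suc j) ⟩
  fromℕ (n !) * (expm1 *ˢ expm1 ^ˢ j) n
    ≡⟨ n!*expm1* (expm1 ^ˢ j) n ⟩
  sum {n} (λ i → fromℕ (n C toℕ i) * (fromℕ (toℕ i !) * (expm1 ^ˢ j) (toℕ i)))
    -- `coeff-F` again, now for each index below `n` and read from right to left.
    ≡⟨ sum-cong-≗ {n} (λ i → trans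
         (coeff-·ᵖ (fromℕ (n C toℕ i)) (F (toℕ i)) j)
         (cong (fromℕ (n C toℕ i) *_) (coeff-F (toℕ i) j))) ⟨
  sum {n} (λ i → coeff (fromℕ (n C toℕ i) ·ᵖ F (toℕ i)) j)
    ≡⟨ coeff-sumᵖ {n} (λ i → fromℕ (n C toℕ i) ·ᵖ F (toℕ i)) j ⟨
  coeff (∑ᵖ[ k < n ] (fromℕ (n C k) ·ᵖ F k)) j
    ≡⟨ coeff-X*-suc (∑ᵖ[ k < n ] (fromℕ (n C k) ·ᵖ F k)) j ⟨
  coeff (X *ᵖ (∑ᵖ[ k < n ] (fromℕ (n C k) ·ᵖ F k))) (suc j) ∎
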